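{- Let $D=(V,A)$ be a digraph, $k\ge 2$ an integer and $F\subseteq A$ such that $\lambda(D)\le \lfloor\frac{k+1}{2}\rfloor$ and the digraph obtained from $D$ by reversing the arcs of $F$ is $k$-arc-connected. Then there exists an arc $\vec a=uv$ of $F$ such that $\lambda(D)\le\lambda(D')$, where $D'$ is the digraph obtained from $D$ by reversing $\vec a$, i.e. replacing the arc $uv$ by the arc $vu$.
   Context: For a digraph $D=(V,A)$, $\lambda(D)=\min\{d_A^-(X): \emptyset\neq X\subsetneq V\}$ denotes its arc-connectivity, where $d_A^-(X)$ is the number of arcs of $A$ entering $X$; $D$ is $k$-arc-connected if $\lambda(D)\ge k$. Reversing an arc $uv$ means replacing it by the arc $vu$. -}

module Defs where

open import Data.Nat using (ℕ; zero; suc; _+_; _≤_)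
open import Data.Bool using (Bool; true; false; if_then_else_; _∧_; not)
open import Data.Fin using (Fin)
open import Data.Fin.Subset using (Subset; _∈_; _∉_; Nonempty)
open import Data.Product using (_×_; _,_; ∃)
open import Data.Vec using (Vec; []; _∷_; lookup; zipWith; _[_]≔_)

-- A digraph on vertex set Fin n with m arcs (parallel arcs and loops allowed);
-- arc j is the pair (tail , head).
Digraph : ℕ → ℕ → Set
Digraph n m = Vec (Fin n × Fin n) m

rev : ∀ {n} → Fin n × Fin n → Fin n × Fin n
rev (u , v) = (v , u)

enters : ∀ {n} → Subset n → Fin n × Fin n → Bool
enters X (u , v) = lookup X v ∧ not (lookup X u)

indeg : ∀ {n m} → Digraph n m → Subset n → ℕ
indeg [] X = 0
indeg (a ∷ as) X = (if enters X a then 1 else 0) + indeg as X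

NonemptyProper : ∀ {n} → Subset n → Set
NonemptyProper X = Nonempty X × ∃ λ v → v ∉ X

-- l is the arc-connectivity λ(D) = min { d⁻(X) : ∅ ≠ X ⊊ V }.
-- (No such l exists when |V| ≤ 1, matching the convention min ∅ = ∞.)
IsArcConnectivity : ∀ {n m} → Digraph n m → ℕ → Set
IsArcConnectivity D l =
  (∃ λ X → NonemptyProper X × indeg D X ≡ l) ×
  (∀ X → NonemptyProper X → l ≤ indeg D X)
  where open import Relation.Binary.PropositionalEquality using (_≡_)

ArcConnected : ∀ {n m} → ℕ → Digraph n m → Set
ArcConnected k D = ∀ X → NonemptyProper X → k ≤ indeg D X

reverseSet : ∀ {n m} → Subset m → Digraph n m → Digraph n m
reverseSet F D = zipWith (λ b a → if b then rev a else a) F D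

reverseArc : ∀ {n m} → Fin m → Digraph n m → Digraph n m
reverseArc j D = D [ j ]≔ rev (lookup D j)

{-# OPTIONS --safe #-}
-- Put K = k − l, so that K ≥ 1 and l ≤ K + 1. A set is tight if its in-degree is l.
-- Reversing an arc lowers the connectivity only if the arc enters a tight set, so assume
-- that every arc of F does. In F, at least K more arcs leave than enter a tight set. By
-- submodularity, if an arc of F leaves a tight X and enters a tight Y, then X and Y are
-- disjoint or X ∪ Y = V. The two cases are exchanged by complementing the sets and reversing
-- all arcs, so it suffices to refute, by induction on |X| for D and its reversal together,
-- an F-arc uv leaving X and entering Z with X ∪ Z = V. Let Z be the least such set that
-- avoids u.
--   If no F-arc goes from X ∩ Z to V ∖ Z, then the at least K + 1 ≥ l F-arcs leaving Z all
-- come from V ∖ X. They, together with uv, violate the submodular inequality of X and Z.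
--   Otherwise the tail of such an arc is avoided by another least tight Z′ with X ∪ Z′ = V
-- and Z ∪ Z′ = V. Intersecting further such sets until no such arc is left yields Y where
-- F-arcs leaving Y exceed those entering it by 2K. All of the former enter X and one F-arc
-- enters Y, which gives 2K + 1 ≤ l.
module Submission where

open import Defs
open import Data.Nat using (ℕ; zero; suc; _+_; _∸_; _≤_; _<_; z≤n; s≤s; ⌊_/2⌋; ⌈_/2⌉)
open import Data.Nat.Properties
open import Data.Nat.Solver using (module +-*-Solver)
open import Data.Bool using (Bool; true; false; if_then_else_; _∧_; _∨_; not)
open import Data.Bool.Properties using (¬-not; ∧-comm; not-involutive)
open import Data.Empty using (⊥; ⊥-elim)
open import Data.Fin using (Fin; zero; suc)
open import Data.Fin.Properties using (any?)
open import Data.Fin.Subset using (Subset; _∈_; _∉_; _⊆_; _∩_; _∪_; ∁; ∣_∣)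
open import Data.Fin.Subset.Properties
open import Data.Product using (_×_; Σ; ∃; _,_; proj₁; proj₂)
open import Data.Sum using (_⊎_; inj₁; inj₂)
open import Data.Vec using ([]; _∷_; lookup)
open import Data.Vec.Properties using (lookup-zipWith; lookup-map; []=⇒lookup; lookup⇒[]=)
open import Function using (_∘_; case_of_)
open import Relation.Nullary using (¬_; Dec; yes; no)
open import Relation.Nullary.Decidable using (¬?; _×-dec_; decidable-stable)
open import Relation.Binary.PropositionalEquality
open import Algebra.Properties.CommutativeMonoid.Sum +-0-commutativeMonoid
  using (sum; sum-cong-≗; ∑-distrib-+)

private variable
  n m : ℕ

-- Counting arcs by Boolean predicates.

bit : Bool → ℕ
bit b = if b then 1 else 0

bit-mono : ∀ {a b} → (a ≡ true → b ≡ true) → bit a ≤ bit b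
bit-mono {false} _ = z≤n
bit-mono {true} a⇒b rewrite a⇒b refl = ≤-refl

-- Abstract, so that unification recovers the predicate from its count.
abstract
  count : (Fin m → Bool) → ℕ
  count p = sum (bit ∘ p)

  count-mono : {p q : Fin m → Bool} → (∀ j → p j ≡ true → q j ≡ true) → count p ≤ count q
  count-mono {zero} _ = z≤n
  count-mono {suc m} {p} {q} p⇒q =
    +-mono-≤ (bit-mono (p⇒q zero)) (count-mono {p = p ∘ suc} {q ∘ suc} (p⇒q ∘ suc))

  count-positive : {p : Fin m → Bool} (j : Fin m) → p j ≡ true → 1 ≤ count p
  count-positive {p = p} zero pj rewrite pj = s≤s z≤n
  count-positive {p = p} (suc j) pj = ≤-trans (count-positive {p = p ∘ suc} j pj) (m≤n+m _ _)

  count-witness : {p : Fin m → Bool} → 1 ≤ count p → ∃ λ j → p j ≡ true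
  count-witness {suc m} {p} 1≤ with p zero in eq
  ... | true = zero , eq
  ... | false = let j , pj = count-witness {p = p ∘ suc} 1≤ in suc j , pj

  count-cong : {p q : Fin m → Bool} → (∀ j → p j ≡ q j) → count p ≡ count q
  count-cong p≗q = sum-cong-≗ (cong bit ∘ p≗q)

  count-+³ : (p q r : Fin m → Bool) →
    count p + (count q + count r) ≡ sum λ j → bit (p j) + (bit (q j) + bit (r j))
  count-+³ p q r = sym (trans (∑-distrib-+ (bit ∘ p) _)
    (cong (count p +_) (∑-distrib-+ (bit ∘ q) (bit ∘ r))))

  count-3≡3 : {p q r p′ q′ r′ : Fin m → Bool} →
    (∀ j → bit (p j) + (bit (q j) + bit (r j)) ≡ bit (p′ j) + (bit (q′ j) + bit (r′ j))) →
    count p + (count q + count r) ≡ count p′ + (count q′ + count r′)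
  count-3≡3 {p = p} {q} {r} {p′} {q′} {r′} pointwise =
    trans (count-+³ p q r) (trans (sum-cong-≗ pointwise) (sym (count-+³ p′ q′ r′)))

  count-4≡2 : {p q r s p′ q′ : Fin m → Bool} →
    (∀ j → bit (p j) + (bit (q j) + (bit (r j) + bit (s j))) ≡ bit (p′ j) + bit (q′ j)) →
    count p + (count q + (count r + count s)) ≡ count p′ + count q′
  count-4≡2 {p = p} {q} {r} {s} {p′} {q′} pointwise =
    trans (cong (count p +_) (count-+³ q r s))
      (trans (sym (∑-distrib-+ (bit ∘ p) _))
        (trans (sum-cong-≗ pointwise) (∑-distrib-+ (bit ∘ p′) (bit ∘ q′))))

  indeg≡count : (D : Digraph n m) (X : Subset n) → indeg D X ≡ count (λ j → enters X (lookup D j))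
  indeg≡count [] X = refl
  indeg≡count (a ∷ D) X = cong (bit (enters X a) +_) (indeg≡count D X)

  -- Reversal loses the arcs of `F` that enter `X` and gains those that leave it. Terms are moved
  -- across to avoid truncated subtraction.
  indeg-reverseSet : (F : Subset m) (D : Digraph n m) (X : Subset n) →
    indeg (reverseSet F D) X + count (λ j → lookup F j ∧ enters X (lookup D j))
    ≡ indeg D X + count (λ j → lookup F j ∧ enters X (rev (lookup D j)))
  indeg-reverseSet [] [] X = refl
  indeg-reverseSet (true ∷ F) (a ∷ D) X =
    +-+-swap (bit (enters X (rev a))) (bit (enters X a)) (indeg-reverseSet F D X)
    where
    +-+-swap : ∀ x y {p q r s} → p + q ≡ r + s → (x + p) + (y + q) ≡ (y + r) + (x + s)
    +-+-swap x y {p} {q} {r} {s} eq = begin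
        (x + p) + (y + q)  ≡⟨ solve 4 (λ x y p q → (x :+ p) :+ (y :+ q) := (x :+ y) :+ (p :+ q)) refl x y p q ⟩
        (x + y) + (p + q)  ≡⟨ cong ((x + y) +_) eq ⟩
        (x + y) + (r + s)  ≡⟨ solve 4 (λ x y r s → (x :+ y) :+ (r :+ s) := (y :+ r) :+ (x :+ s)) refl x y r s ⟩
        (y + r) + (x + s)  ∎
      where
      open ≡-Reasoning
      open +-*-Solver
  indeg-reverseSet (false ∷ F) (a ∷ D) X =
    trans (+-assoc (bit (enters X a)) _ _)
      (trans (cong (bit (enters X a) +_) (indeg-reverseSet F D X)) (sym (+-assoc (bit (enters X a)) _ _)))

-- Entering arcs and covering pairs of sets.

Enters : Subset n → Fin n × Fin n → Set
Enters X (u , v) = v ∈ X × u ∉ X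

Leaves : Subset n → Fin n × Fin n → Set
Leaves X a = Enters X (rev a)

Covering : Subset n → Subset n → Set
Covering X Y = ∀ {w} → w ∉ X → w ∈ Y

covering-sym : (X Y : Subset n) → Covering X Y → Covering Y X
covering-sym X Y cov w∉Y = decidable-stable (_ ∈? X) (λ w∉X → w∉Y (cov w∉X))

covering? : (X Y : Subset n) → Covering X Y ⊎ ∃ λ w → w ∉ X × w ∉ Y
covering? X Y with any? (λ w → ¬? (w ∈? X) ×-dec ¬? (w ∈? Y))
... | yes w = inj₂ w
... | no none = inj₁ λ {w} w∉X → decidable-stable (w ∈? Y) (λ w∉Y → none (w , w∉X , w∉Y))

coveringDec : (X Y : Subset n) → Dec (Covering X Y)
coveringDec X Y with covering? X Y
... | inj₁ cov = yes cov
... | inj₂ (w , w∉X , w∉Y) = no λ cov → w∉Y (cov w∉X)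

∉⇒lookup : {X : Subset n} {v : Fin n} → v ∉ X → lookup X v ≡ false
∉⇒lookup {X = X} {v} v∉X = ¬-not (v∉X ∘ lookup⇒[]= v X)

lookup⇒∉ : {X : Subset n} {v : Fin n} → lookup X v ≡ false → v ∉ X
lookup⇒∉ eq v∈X with trans (sym ([]=⇒lookup v∈X)) eq
... | ()

enters⁺ : {X : Subset n} {a : Fin n × Fin n} → Enters X a → enters X a ≡ true
enters⁺ (v∈X , u∉X) rewrite []=⇒lookup v∈X | ∉⇒lookup u∉X = refl

∧-true : ∀ {a b} → a ∧ b ≡ true → a ≡ true × b ≡ true
∧-true {true} eq = refl , eq

enters⁻ : {X : Subset n} {a : Fin n × Fin n} → enters X a ≡ true → Enters X a
enters⁻ {X = X} {u , v} eq with lookup X v in eqv | lookup X u in equ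
... | true | false = lookup⇒[]= v X eqv , lookup⇒∉ equ

enters? : (X : Subset n) (a : Fin n × Fin n) → Dec (Enters X a)
enters? X (u , v) = (v ∈? X) ×-dec ¬? (u ∈? X)

covering⇒∨ : {X Y : Subset n} → Covering X Y → ∀ w → lookup X w ∨ lookup Y w ≡ true
covering⇒∨ {X = X} cov w with lookup X w in eq
... | true = refl
... | false = []=⇒lookup (cov (lookup⇒∉ eq))

enters-∁ : (X : Subset n) (a : Fin n × Fin n) → enters (∁ X) a ≡ enters X (rev a)
enters-∁ X (u , v) rewrite lookup-map v not X | lookup-map u not X
  | not-involutive (lookup X u) = ∧-comm (not (lookup X v)) (lookup X u)

-- Per-arc identities behind submodularity.

submodular-bits : ∀ xu xv yu yv →
  bit ((xv ∧ yv) ∧ not (xu ∧ yu)) + (bit ((xv ∨ yv) ∧ not (xu ∨ yu))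
    + (bit ((yv ∧ not yu) ∧ (xu ∧ not xv)) + bit ((xv ∧ not xu) ∧ (yu ∧ not yv))))
  ≡ bit (xv ∧ not xu) + bit (yv ∧ not yu)
submodular-bits false false false false = refl
submodular-bits false false false true  = refl
submodular-bits false false true  false = refl
submodular-bits false false true  true  = refl
submodular-bits false true  false false = refl
submodular-bits false true  false true  = refl
submodular-bits false true  true  false = refl
submodular-bits false true  true  true  = refl
submodular-bits true  false false false = refl
submodular-bits true  false false true  = refl
submodular-bits true  false true  false = refl
submodular-bits true  false true  true  = refl
submodular-bits true  true  false false = refl
submodular-bits true  true  false true  = refl
submodular-bits true  true  true  false = refl
submodular-bits true  true  true  true  = refl

-- Leaving minus entering is modular in the set and vanishes on `X ∪ Y` = V. The bit `b` stands for
-- membership in `F`.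
modular-bits : ∀ b xu xv yu yv → xu ∨ yu ≡ true → xv ∨ yv ≡ true →
  bit (b ∧ ((xv ∧ yv) ∧ not (xu ∧ yu))) + (bit (b ∧ (xu ∧ not xv)) + bit (b ∧ (yu ∧ not yv)))
  ≡ bit (b ∧ ((xu ∧ yu) ∧ not (xv ∧ yv))) + (bit (b ∧ (xv ∧ not xu)) + bit (b ∧ (yv ∧ not yu)))
modular-bits false _ _ _ _ _ _ = refl
modular-bits true false false true  true  _ _ = refl
modular-bits true false true  true  false _ _ = refl
modular-bits true false true  true  true  _ _ = refl
modular-bits true true  false false true  _ _ = refl
modular-bits true true  false true  true  _ _ = refl
modular-bits true true  true  false false _ _ = refl
modular-bits true true  true  false true  _ _ = refl
modular-bits true true  true  true  false _ _ = refl
modular-bits true true  true  true  true  _ _ = refl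

-- Least members of intersection-closed families.

least : (P : Subset n → Set) → (∀ X → Dec (P X)) → (∀ {X Y} → P X → P Y → P (X ∩ Y)) →
  ∀ {X} → P X → ∃ λ Z → P Z × (∀ {Y} → P Y → Z ⊆ Y)
least P P? ∩-closed {X} PX = go (suc ∣ X ∣) PX ≤-refl
  where
  go : ∀ s {X} → P X → ∣ X ∣ < s → ∃ λ Z → P Z × (∀ {Y} → P Y → Z ⊆ Y)
  go (suc s) {X} PX (s≤s ∣X∣≤s) with anySubset? (λ Y → P? Y ×-dec any? (λ x → (x ∈? X) ×-dec ¬? (x ∈? Y)))
  ... | no none = X , PX , λ {Y} PY {x} x∈X →
    decidable-stable (x ∈? Y) (λ x∉Y → none (Y , PY , x , x∈X , x∉Y))
  -- The member `Y` misses `x`, so `X ∩ Y` is a strictly smaller member.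
  ... | yes (Y , PY , x , x∈X , x∉Y) = go s (∩-closed PX PY)
    (≤-trans (p⊂q⇒∣p∣<∣q∣ (p∩q⊆p X Y , x , x∈X , x∉Y ∘ p∩q⊆q X Y)) ∣X∣≤s)

∉∩ˡ : {X Y : Subset n} {w : Fin n} → w ∉ X → w ∉ X ∩ Y
∉∩ˡ {X = X} {Y} w∉X = w∉X ∘ p∩q⊆p X Y

∉∪ : {X Y : Subset n} {w : Fin n} → w ∉ X → w ∉ Y → w ∉ X ∪ Y
∉∪ {X = X} {Y} w∉X w∉Y w∈ with x∈p∪q⁻ X Y w∈
... | inj₁ w∈X = w∉X w∈X
... | inj₂ w∈Y = w∉Y w∈Y

-- Tight sets and the surplus of `F`-arcs.

module Fixed {n m : ℕ} (F : Subset m) (l K : ℕ) (1≤K : 1 ≤ K) (l≤1+K : l ≤ suc K) where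

  Arcs : Set
  Arcs = Fin m → Fin n × Fin n

  din : Arcs → Subset n → ℕ
  din arc X = count λ j → enters X (arc j)

  -- The arcs from `X ∩ ∁ Y` to `Y ∩ ∁ X`.
  cross : Arcs → Subset n → Subset n → ℕ
  cross arc X Y = count λ j → enters Y (arc j) ∧ enters X (rev (arc j))

  fin fout : Arcs → Subset n → ℕ
  fin arc X = count λ j → lookup F j ∧ enters X (arc j)
  fout arc X = count λ j → lookup F j ∧ enters X (rev (arc j))

  Tight : Arcs → Subset n → Set
  Tight arc X = NonemptyProper X × din arc X ≡ l

  tight? : ∀ arc X → Dec (Tight arc X)
  tight? arc X = (nonempty? X ×-dec any? (λ v → ¬? (v ∈? X))) ×-dec (din arc X ≟ l)

  -- The situation to be refuted: no F-arc can be reversed without lowering the connectivity.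
  record Stuck (arc : Arcs) : Set where
    field
      lower : ∀ {X} → NonemptyProper X → l ≤ din arc X
      gain  : ∀ {X} → Tight arc X → K + fin arc X ≤ fout arc X
      cover : ∀ {j} → j ∈ F → ∃ λ X → Tight arc X × Enters X (arc j)

  -- An equality, because the diagonal arcs are counted in both directions.
  din-submodular : ∀ arc X Y →
    din arc (X ∩ Y) + (din arc (X ∪ Y) + (cross arc X Y + cross arc Y X)) ≡ din arc X + din arc Y
  din-submodular arc X Y =
    count-4≡2 (pointwise ∘ arc)
    where
    pointwise : ∀ a → bit (enters (X ∩ Y) a) + (bit (enters (X ∪ Y) a)
        + (bit (enters Y a ∧ enters X (rev a)) + bit (enters X a ∧ enters Y (rev a))))
      ≡ bit (enters X a) + bit (enters Y a)
    pointwise (u , v)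
      rewrite lookup-zipWith _∧_ v X Y | lookup-zipWith _∧_ u X Y
            | lookup-zipWith _∨_ v X Y | lookup-zipWith _∨_ u X Y
      = submodular-bits (lookup X u) (lookup X v) (lookup Y u) (lookup Y v)

  f-modular : ∀ arc {X Y} → Covering X Y →
    fin arc (X ∩ Y) + (fout arc X + fout arc Y) ≡ fout arc (X ∩ Y) + (fin arc X + fin arc Y)
  f-modular arc {X} {Y} cov =
    count-3≡3 pointwise
    where
    pointwise : ∀ j →
      bit (lookup F j ∧ enters (X ∩ Y) (arc j))
        + (bit (lookup F j ∧ enters X (rev (arc j))) + bit (lookup F j ∧ enters Y (rev (arc j))))
      ≡ bit (lookup F j ∧ enters (X ∩ Y) (rev (arc j)))
        + (bit (lookup F j ∧ enters X (arc j)) + bit (lookup F j ∧ enters Y (arc j)))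
    pointwise j
      rewrite lookup-zipWith _∧_ (proj₁ (arc j)) X Y | lookup-zipWith _∧_ (proj₂ (arc j)) X Y
      = modular-bits (lookup F j)
          (lookup X (proj₁ (arc j))) (lookup X (proj₂ (arc j)))
          (lookup Y (proj₁ (arc j))) (lookup Y (proj₂ (arc j)))
          (covering⇒∨ {X = X} {Y} cov (proj₁ (arc j))) (covering⇒∨ {X = X} {Y} cov (proj₂ (arc j)))

  -- The surplus of leaving over entering `F`-arcs is additive over a covering pair, so its lower
  -- bounds add up.
  excess-∩ : ∀ {arc X Y a b} → Covering X Y → a + fin arc X ≤ fout arc X → b + fin arc Y ≤ fout arc Y →
    a + b + fin arc (X ∩ Y) ≤ fout arc (X ∩ Y)
  excess-∩ {arc} {X} {Y} {a} {b} cov exX exY = +-cancelʳ-≤ (fin arc X + fin arc Y) _ _ (begin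
      a + b + fin arc (X ∩ Y) + (fin arc X + fin arc Y)
        ≡⟨ solve 5 (λ a b p x y → a :+ b :+ p :+ (x :+ y) := p :+ ((a :+ x) :+ (b :+ y))) refl
             a b (fin arc (X ∩ Y)) (fin arc X) (fin arc Y) ⟩
      fin arc (X ∩ Y) + ((a + fin arc X) + (b + fin arc Y))
        ≤⟨ +-monoʳ-≤ (fin arc (X ∩ Y)) (+-mono-≤ exX exY) ⟩
      fin arc (X ∩ Y) + (fout arc X + fout arc Y)
        ≡⟨ f-modular arc cov ⟩
      fout arc (X ∩ Y) + (fin arc X + fin arc Y) ∎)
    where
    open ≤-Reasoning
    open +-*-Solver

  F-mono : {P Q : Fin m → Bool} → (∀ {j} → j ∈ F → P j ≡ true → Q j ≡ true) →
    count (λ j → lookup F j ∧ P j) ≤ count (λ j → lookup F j ∧ Q j)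
  F-mono P⇒Q = count-mono λ j eq →
    let Fj , Pj = ∧-true eq in cong₂ _∧_ Fj (P⇒Q (lookup⇒[]= j F Fj) Pj)

  F-positive : {P : Fin m → Bool} {j : Fin m} → j ∈ F → P j ≡ true → 1 ≤ count (λ j → lookup F j ∧ P j)
  F-positive {j = j} j∈F Pj = count-positive j (cong₂ _∧_ ([]=⇒lookup j∈F) Pj)

  complement-proper : ∀ {X : Subset n} → NonemptyProper X → NonemptyProper (∁ X)
  complement-proper ((x , x∈X) , (y , y∉X)) = (y , x∉p⇒x∈∁p y∉X) , (x , x∈p⇒x∉∁p x∈X)

  complement-tight : ∀ {arc X} → Tight arc X → Tight (rev ∘ arc) (∁ X)
  complement-tight {arc} {X} (proper , eq) =
    complement-proper proper , trans (count-cong λ j → enters-∁ X (rev (arc j))) eq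

  -- Complementing a set and reversing all arcs each exchange entering with leaving, so together
  -- they preserve every count.
  reverse-stuck : ∀ {arc} → Stuck arc → Stuck (rev ∘ arc)
  reverse-stuck {arc} stuck = record
    { lower = λ {X} proper →
        subst (l ≤_) (count-cong λ j → enters-∁ X (arc j)) (lower (complement-proper proper))
    ; gain = λ {X} tight → subst₂ (λ a b → K + a ≤ b)
        (count-cong λ j → cong (lookup F j ∧_) (enters-∁ X (arc j)))
        (count-cong λ j → cong (lookup F j ∧_) (enters-∁ X (rev (arc j))))
        (gain (complement-tight tight))
    ; cover = λ {j} j∈F →
        let X , tight , v∈X , u∉X = cover j∈F
        in ∁ X , complement-tight tight , x∉p⇒x∈∁p u∉X , x∈p⇒x∉∁p v∈X
    }
    where open Stuck stuck

  -- Uncrossing tight sets.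

  module Uncrossing {arc : Arcs} (stuck : Stuck arc) where
    open Stuck stuck

    tight-sum : ∀ {X Y} → Tight arc X → Tight arc Y →
      din arc (X ∩ Y) + (din arc (X ∪ Y) + (cross arc X Y + cross arc Y X)) ≡ l + l
    tight-sum {X} {Y} (_ , eqX) (_ , eqY) = trans (din-submodular arc X Y) (cong₂ _+_ eqX eqY)

    module _ {X Y : Subset n} (tX : Tight arc X) (tY : Tight arc Y) {x z : Fin n}
      (x∈X : x ∈ X) (x∈Y : x ∈ Y) (z∉X : z ∉ X) (z∉Y : z ∉ Y) where

      private
        proper∩ : NonemptyProper (X ∩ Y)
        proper∩ = (x , x∈p∩q⁺ (x∈X , x∈Y)) , (z , ∉∩ˡ z∉X)

        l≤∪ : l ≤ din arc (X ∪ Y)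
        l≤∪ = lower ((x , x∈p∪q⁺ (inj₁ x∈X)) , (z , ∉∪ z∉X z∉Y))

      -- Intersection and union are both nonempty and proper, so each has in-degree at least `l`,
      -- while the sum is at most `l + l`.
      tight-∩ : Tight arc (X ∩ Y)
      tight-∩ = proper∩ , ≤-antisym (+-cancelʳ-≤ l _ _ (begin
          din arc (X ∩ Y) + l                ≤⟨ +-monoʳ-≤ (din arc (X ∩ Y)) l≤∪ ⟩
          din arc (X ∩ Y) + din arc (X ∪ Y)  ≤⟨ +-monoʳ-≤ (din arc (X ∩ Y)) (m≤m+n _ _) ⟩
          din arc (X ∩ Y) + (din arc (X ∪ Y) + (cross arc X Y + cross arc Y X))
                                             ≡⟨ tight-sum tX tY ⟩
          l + l                              ∎))
        (lower proper∩)
        where open ≤-Reasoning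

      -- A diagonal arc would push the submodular sum beyond `l + l`.
      no-diagonal : ∀ j → Leaves X (arc j) → Enters Y (arc j) → ⊥
      no-diagonal j leavesX entersY = <-irrefl refl (begin-strict
          l + l              <⟨ +-monoʳ-< l (m<m+n l
                                 (count-positive j (cong₂ _∧_ (enters⁺ entersY) (enters⁺ leavesX)))) ⟩
          l + (l + cross arc X Y)
            ≤⟨ +-mono-≤ (lower proper∩) (+-mono-≤ l≤∪ (m≤m+n _ _)) ⟩
          din arc (X ∩ Y) + (din arc (X ∪ Y) + (cross arc X Y + cross arc Y X))
                             ≡⟨ tight-sum tX tY ⟩
          l + l              ∎)
        where open ≤-Reasoning

    disjoint-or-covering : ∀ {X Y} j → Tight arc X → Tight arc Y →
      Leaves X (arc j) → Enters Y (arc j) → (∀ {w} → w ∈ X → w ∉ Y) ⊎ Covering X Y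
    disjoint-or-covering {X} {Y} j tX tY leavesX entersY
      with any? (λ w → (w ∈? X) ×-dec (w ∈? Y)) | covering? X Y
    ... | no none | _ = inj₁ λ {w} w∈X w∈Y → none (w , w∈X , w∈Y)
    ... | yes _ | inj₁ cov = inj₂ cov
    ... | yes (w , w∈X , w∈Y) | inj₂ (z , z∉X , z∉Y) =
      ⊥-elim (no-diagonal tX tY w∈X w∈Y z∉X z∉Y j leavesX entersY)

    -- The two sets are complements, so the surplus of one is the negative of that of the other;
    -- both cannot be positive.
    tight-excess : ∀ {X Y} → Tight arc X → Tight arc Y → Covering X Y →
      (∀ {w} → w ∈ X → w ∉ Y) → ⊥
    tight-excess {X} {Y} tX tY cov disjoint = <-irrefl refl (begin-strict
        fin arc X         <⟨ m<n+m _ 1≤K ⟩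
        K + fin arc X     ≤⟨ gain tX ⟩
        fout arc X        ≤⟨ F-mono (λ {j} _ eq → let u∈X , v∉X = enters⁻ {X = X} {a = rev (arc j)} eq
                               in enters⁺ {X = Y} {a = arc j} (cov v∉X , disjoint u∈X)) ⟩
        fin arc Y         ≤⟨ m≤n+m _ K ⟩
        K + fin arc Y     ≤⟨ gain tY ⟩
        fout arc Y        ≤⟨ F-mono (λ {j} _ eq → let u∈Y , v∉Y = enters⁻ {X = Y} {a = rev (arc j)} eq
                               in enters⁺ {X = X} {a = arc j}
                                    (covering-sym X Y cov v∉Y , λ u∈X → disjoint u∈X u∈Y)) ⟩
        fin arc X         ∎)
      where open ≤-Reasoning

  -- The excluded configuration and its dual.

  CoveringFree : Arcs → Subset n → Set
  CoveringFree arc X = ∀ {Z j} → Tight arc Z → Covering X Z → j ∈ F →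
    Leaves X (arc j) → Enters Z (arc j) → ⊥

  -- Disjoint sets have covering complements, and the reversed arc leaves `∁ X` and enters `∁ Y`.
  disjoint-free : ∀ {arc X Y j} → CoveringFree (rev ∘ arc) (∁ X) → Tight arc Y →
    (∀ {w} → w ∈ X → w ∉ Y) → j ∈ F → Leaves X (arc j) → Enters Y (arc j) → ⊥
  disjoint-free free tY disjoint j∈F (u∈X , v∉X) (v∈Y , u∉Y) =
    free (complement-tight tY) (x∉p⇒x∈∁p ∘ disjoint ∘ x∉∁p⇒x∈p) j∈F
      (x∉p⇒x∈∁p v∉X , x∈p⇒x∉∁p u∈X) (x∉p⇒x∈∁p u∉Y , x∈p⇒x∉∁p v∈Y)

  -- Induction step at a tight set: least covering sets.

  module Minimal {arc : Arcs} (stuck : Stuck arc) {X : Subset n} (tX : Tight arc X)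
    (smaller : ∀ {W} → ∣ W ∣ < ∣ X ∣ → Tight arc W → CoveringFree arc W)
    (smaller′ : ∀ {W} → ∣ W ∣ < ∣ X ∣ → Tight (rev ∘ arc) W → CoveringFree (rev ∘ arc) W)
    where
    open Stuck stuck
    open Uncrossing stuck

    Avoiding : Fin n → Subset n → Set
    Avoiding x Z = Tight arc Z × Covering X Z × x ∉ Z

    avoiding? : ∀ x Z → Dec (Avoiding x Z)
    avoiding? x Z = tight? arc Z ×-dec (coveringDec X Z ×-dec ¬? (x ∈? Z))

    -- Both sets contain everything outside `X` and both miss `x`, so uncrossing applies.
    avoiding-∩ : ∀ {x Y Z} → Avoiding x Y → Avoiding x Z → Avoiding x (Y ∩ Z)
    avoiding-∩ (tY , covY , x∉Y) (tZ , covZ , x∉Z) =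
      let z , z∉X = proj₂ (proj₁ tX) in
      tight-∩ tY tZ (covY z∉X) (covZ z∉X) x∉Y x∉Z ,
      (λ w∉X → x∈p∩q⁺ (covY w∉X , covZ w∉X)) , ∉∩ˡ x∉Y

    Least : Fin n → Subset n → Set
    Least x Z = Avoiding x Z × (∀ {Y} → Avoiding x Y → Z ⊆ Y)

    least-avoiding : ∀ {x Z} → Avoiding x Z → ∃ (Least x)
    least-avoiding {x} = least (Avoiding x) (avoiding? x) avoiding-∩

    -- For `Y` avoiding `y`, the set `Z ∩ Y` still avoids `x`, so minimality puts `Z` inside it.
    least-transfer : ∀ {x y Z} → Least x Z → y ∉ Z → Least y Z
    least-transfer {x} {y} {Z} (avx@(tZ , covZ , _) , min) y∉Z = avy , λ {Y} avY →
      p∩q⊆q Z Y ∘ min (let tZY , covZY , _ = avoiding-∩ avy avY in tZY , covZY , ∉∩ˡ (proj₂ (proj₂ avx)))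
      where
      avy : Avoiding y Z
      avy = tZ , covZ , y∉Z

    -- No tight W satisfies V ∖ Z ⊆ W ⊊ X.
    Sealed : Subset n → Set
    Sealed Z = ∀ {W x} → Tight arc W → Covering Z W → W ⊆ X → x ∈ X → x ∉ W → ⊥

    -- The arc leaves `W` and enters `Z`, which is the excluded configuration for the smaller set
    -- `W`.
    not-between : ∀ {Z W x j} → Tight arc Z → Tight arc W → Covering Z W → W ⊆ X → x ∈ X → x ∉ W →
      j ∈ F → proj₁ (arc j) ∉ Z → proj₂ (arc j) ∈ Z → proj₂ (arc j) ∉ W → ⊥
    not-between {Z} {W} tZ tW cov W⊆X x∈X x∉W j∈F u∉Z v∈Z v∉W =
      smaller (p⊂q⇒∣p∣<∣q∣ (W⊆X , _ , x∈X , x∉W)) tW tZ (covering-sym Z W cov) j∈F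
        (cov u∉Z , v∉W) (v∈Z , u∉Z)

    -- V ∖ Y is a union of complements of least sets, any two of which are equal or disjoint.
    Closed : Subset n → Set
    Closed Y = ∀ {y} → y ∉ Y → ∃ λ Z → Least y Z × Sealed Z × Y ⊆ Z

    closed-∩ : ∀ {x Y Z} → Closed Y → Least x Z → Sealed Z → Closed (Y ∩ Z)
    closed-∩ {Y = Y} {Z} closed leastZ sealed {y} y∉ with y ∈? Y
    ... | no y∉Y = let Zy , leasty , sealedy , Y⊆Zy = closed y∉Y
                   in Zy , leasty , (λ {W} {x} → sealedy {W} {x}) , (λ w∈ → Y⊆Zy (p∩q⊆p Y Z w∈))
    ... | yes y∈Y = Z , least-transfer leastZ (λ y∈Z → y∉ (x∈p∩q⁺ (y∈Y , y∈Z)))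
                  , (λ {W} {x} → sealed {W} {x}) , p∩q⊆q Y Z

    InnerArc : Subset n → Fin m → Set
    InnerArc Y j = j ∈ F × Leaves Y (arc j) × proj₁ (arc j) ∈ X

    innerArc? : ∀ Y → Dec (∃ (InnerArc Y))
    innerArc? Y = any? λ j → (j ∈? F) ×-dec (enters? Y (rev (arc j)) ×-dec (proj₁ (arc j) ∈? X))

    -- The new set is the least one avoiding the tail of the inner arc. It covers together with `Y`,
    -- so surpluses add, and closedness survives, so the step can be repeated.
    shrink : ∀ {Y j} → Covering X Y → Closed Y → InnerArc Y j →
      ∃ λ Z → Tight arc Z × Covering X Z × Covering Y Z × Closed (Y ∩ Z) × proj₁ (arc j) ∉ Z
    shrink {Y} {j} covY closed (j∈F , (u∈Y , v∉Y) , u∈X) =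
      let Zv , leastv@((tZv , covZv , v∉Zv) , minv) , sealedv , Y⊆Zv = closed v∉Y
          u∈Zv = Y⊆Zv u∈Y
          W , tW , v∈W , u∉W = cover j∈F
          v∈X = covering-sym X Y covY v∉Y

          -- In the disjoint case the reversed digraph has the excluded configuration at `∁ Zv`,
          -- which lies in `X` and misses `u`.
          covZvW : Covering Zv W
          covZvW = case disjoint-or-covering j tZv tW (u∈Zv , v∉Zv) (v∈W , u∉W) of λ where
            (inj₂ cov) → cov
            (inj₁ disjoint) → ⊥-elim (disjoint-free
              (smaller′ (p⊂q⇒∣p∣<∣q∣ ( (λ w∈∁Z → covering-sym X Zv covZv (x∈∁p⇒x∉p w∈∁Z))
                                     , u , u∈X , x∈p⇒x∉∁p u∈Zv))
                (complement-tight tZv))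
              tW disjoint j∈F (u∈Zv , v∉Zv) (v∈W , u∉W))

          -- Otherwise `X ∩ W` is tight, contains `∁ Zv` and misses `u`, so `Zv` is not sealed.
          covXW : Covering X W
          covXW = case covering? X W of λ where
            (inj₁ cov) → cov
            (inj₂ (z , z∉X , z∉W)) → ⊥-elim (sealedv (tight-∩ tX tW v∈X v∈W z∉X z∉W)
              (λ w∉Zv → x∈p∩q⁺ (covering-sym X Zv covZv w∉Zv , covZvW w∉Zv))
              (p∩q⊆p X W) u∈X (u∉W ∘ p∩q⊆q X W))

          Zu , leastu@((tZu , covZu , u∉Zu) , _) = least-avoiding (tW , covXW , u∉W)

          -- If `w` were outside both, `Zv` would be least for `w` and hence lie inside `Zu`,
          -- although only `Zv` contains `u`.
          meets : ∀ {w} → w ∉ Zv → w ∈ Zu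
          meets {w} w∉Zv = decidable-stable (w ∈? Zu) λ w∉Zu →
            u∉Zu (proj₂ (least-transfer leastv w∉Zv) (tZu , covZu , w∉Zu) u∈Zv)

          sealedu : Sealed Zu
          sealedu {W′} {x} tW′ covZuW′ W′⊆X x∈X x∉W′ = case v ∈? W′ of λ where
            (no v∉W′) → not-between tZu tW′ covZuW′ W′⊆X x∈X x∉W′ j∈F u∉Zu (meets v∉Zv) v∉W′
            (yes v∈W′) → case covering? Zv W′ of λ where
              (inj₁ cov) → sealedv tW′ cov W′⊆X x∈X x∉W′
              -- Intersecting with `Zv` removes `v` and returns to the case above.
              (inj₂ (z , z∉Zv , z∉W′)) → not-between tZu
                (tight-∩ tW′ tZv (covZuW′ u∉Zu) u∈Zv z∉W′ z∉Zv)
                (λ {w} w∉Zu → x∈p∩q⁺ ( covZuW′ w∉Zu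
                                     , decidable-stable (w ∈? Zv) (w∉Zu ∘ meets)))
                (W′⊆X ∘ p∩q⊆p W′ Zv) x∈X (∉∩ˡ x∉W′) j∈F u∉Zu (meets v∉Zv) (v∉Zv ∘ p∩q⊆q W′ Zv)

          -- Outside both, the least set for `y` would lie inside `Zu` and yet contain `Y`, hence
          -- `u`.
          covYZu : Covering Y Zu
          covYZu {y} y∉Y = decidable-stable (y ∈? Zu) λ y∉Zu →
            let _ , (_ , miny) , _ , Y⊆Zy = closed y∉Y
            in u∉Zu (miny (tZu , covZu , y∉Zu) (Y⊆Zy u∈Y))
      in Zu , tZu , covZu , covYZu , closed-∩ closed leastu (λ {W} {x} → sealedu {W} {x}) , u∉Zu
      where
      u v : Fin n
      u = proj₁ (arc j)
      v = proj₂ (arc j)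

    -- Refuting an `F`-arc from `X` into a covering tight set.

    module _ {i : Fin m} (i∈F : i ∈ F) (u∈X : proj₁ (arc i) ∈ X) (v∉X : proj₂ (arc i) ∉ X) where

      fin-positive : ∀ {Y} → Covering X Y → proj₁ (arc i) ∉ Y → 1 ≤ fin arc Y
      fin-positive {Y} cov u∉Y = F-positive i∈F (enters⁺ {X = Y} {a = arc i} (cov v∉X , u∉Y))

      -- With no inner arc, an `F`-arc leaving `Y` starts outside `X`; its head is outside `Y`,
      -- hence in `X`.
      fout-bound : ∀ {Y} → Covering X Y → ¬ ∃ (InnerArc Y) → fout arc Y ≤ cross arc Y X
      fout-bound {Y} cov none = count-mono λ j eq →
        let Fj , out = ∧-true eq
            u∈Y , v∉Y = enters⁻ {X = Y} {a = rev (arc j)} out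
        in cong₂ _∧_
          (enters⁺ {X = X} {a = arc j} ( covering-sym X Y cov v∉Y
                   , λ u∈X → none (j , lookup⇒[]= j F Fj , (u∈Y , v∉Y) , u∈X)))
          out

      cross≤l : ∀ {Y} → cross arc Y X ≤ l
      cross≤l = ≤-trans (count-mono λ j → proj₁ ∘ ∧-true) (≤-reflexive (proj₂ tX))

      -- Each inner arc allows `Y` to shrink. Once none is left, the `F`-arcs leaving `Y` all enter
      -- the tight set `X`, too few for surplus `K + K`.
      excess-absurd : ∀ {Y} → Covering X Y → Closed Y → proj₁ (arc i) ∉ Y →
        K + K + fin arc Y ≤ fout arc Y → ⊥
      excess-absurd {Y} cov closed u∉Y = go (suc ∣ Y ∣) ≤-refl cov closed u∉Y
        where
        go : ∀ s {Y} → ∣ Y ∣ < s → Covering X Y → Closed Y → proj₁ (arc i) ∉ Y →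
          K + K + fin arc Y ≤ fout arc Y → ⊥
        go (suc s) {Y} (s≤s ∣Y∣≤s) cov closed u∉Y excess with innerArc? Y
        ... | no none = <-irrefl refl (begin-strict
              K + K + fin arc Y  ≤⟨ excess ⟩
              fout arc Y         ≤⟨ fout-bound cov none ⟩
              cross arc Y X      ≤⟨ cross≤l {Y} ⟩
              l                  ≤⟨ l≤1+K ⟩
              1 + K              <⟨ s≤s (m<m+n K 1≤K) ⟩
              1 + (K + K)        ≡⟨ +-comm 1 (K + K) ⟩
              -- The extra one is the arc `i`, which enters `Y`.
              K + K + 1          ≤⟨ +-monoʳ-≤ (K + K) (fin-positive cov u∉Y) ⟩
              K + K + fin arc Y  ∎)
            where open ≤-Reasoning
        ... | yes (j , inner@(_ , (u′∈Y , _) , _)) =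
          let Z , tZ , covXZ , covYZ , closed′ , u′∉Z = shrink cov closed inner
          in go s
            (≤-trans (p⊂q⇒∣p∣<∣q∣ (p∩q⊆p Y Z , _ , u′∈Y , u′∉Z ∘ p∩q⊆q Y Z)) ∣Y∣≤s)
            (λ {w} w∉X → x∈p∩q⁺ (cov w∉X , covXZ w∉X))
            closed′ (∉∩ˡ u∉Y) (≤-trans
              -- Shrinking raises the surplus bound to `K + K + K`; the third `K` is dropped to keep
              -- the invariant.
              (+-monoˡ-≤ (fin arc (Y ∩ Z)) (m≤m+n (K + K) K))
              (excess-∩ covYZ excess (gain tZ)))

      covering-free : ∀ {Z} → Tight arc Z → Covering X Z → proj₁ (arc i) ∉ Z → ⊥
      covering-free tZ₀ covZ₀ u∉Z₀ with least-avoiding (tZ₀ , covZ₀ , u∉Z₀)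
      ... | Z , leastZ@((tZ , cov , u∉Z) , _) with innerArc? Z
      ...   | yes (j , inner) =
        let Z′ , tZ′ , covXZ′ , covZZ′ , closed′ , _ = shrink cov closed inner
        in excess-absurd (λ w∉X → x∈p∩q⁺ (cov w∉X , covXZ′ w∉X)) closed′ (∉∩ˡ u∉Z)
             (excess-∩ covZZ′ (gain tZ) (gain tZ′))
        where
        closed : Closed Z
        closed y∉Z = Z , least-transfer leastZ y∉Z , (λ {W} {x} → sealed {W} {x}) , λ x∈Z → x∈Z
          where
          sealed : Sealed Z
          -- The arc `i` itself leaves such a `W` and enters `Z`.
          sealed tW covZW W⊆X x∈X x∉W =
            not-between tZ tW covZW W⊆X x∈X x∉W i∈F u∉Z (cov v∉X) (v∉X ∘ W⊆X)
      ...   | no none with nonempty? (X ∩ Z)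
      ...     | no empty = tight-excess tX tZ cov λ w∈X w∈Z → empty (_ , x∈p∩q⁺ (w∈X , w∈Z))
      -- The intersection and the diagonal arcs from `Z` to `X` contribute `l` each; the arc `i`,
      -- diagonal the other way, makes the sum too large.
      ...     | yes meet = <-irrefl refl (begin-strict
        l + l
          ≤⟨ +-mono-≤ (lower (meet , _ , ∉∩ˡ v∉X)) l≤cross ⟩
        din arc (X ∩ Z) + cross arc Z X
          <⟨ +-monoʳ-< (din arc (X ∩ Z)) (m<n+m (cross arc Z X) cross-positive) ⟩
        din arc (X ∩ Z) + (cross arc X Z + cross arc Z X)
          ≤⟨ +-monoʳ-≤ (din arc (X ∩ Z)) (m≤n+m _ (din arc (X ∪ Z))) ⟩
        din arc (X ∩ Z) + (din arc (X ∪ Z) + (cross arc X Z + cross arc Z X))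
          ≡⟨ tight-sum tX tZ ⟩
        l + l ∎)
        where
        open ≤-Reasoning

        cross-positive : 1 ≤ cross arc X Z
        cross-positive = count-positive i (cong₂ _∧_
          (enters⁺ {X = Z} {a = arc i} (cov v∉X , u∉Z))
          (enters⁺ {X = X} {a = rev (arc i)} (u∈X , v∉X)))

        l≤cross : l ≤ cross arc Z X
        l≤cross = begin
          l              ≤⟨ l≤1+K ⟩
          1 + K          ≡⟨ +-comm 1 K ⟩
          K + 1          ≤⟨ +-monoʳ-≤ K (fin-positive cov u∉Z) ⟩
          K + fin arc Z  ≤⟨ gain tZ ⟩
          fout arc Z     ≤⟨ fout-bound cov none ⟩
          cross arc Z X  ∎

  -- Induction for a digraph and its reversal together.

  no-covering : ∀ s {arc} → Stuck arc → ∀ {X} → ∣ X ∣ < s → Tight arc X → CoveringFree arc X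
  no-covering (suc s) stuck (s≤s ∣X∣≤s) tX tZ cov j∈F (u∈X , v∉X) (v∈Z , u∉Z) =
    Minimal.covering-free stuck tX
      (λ W<X → no-covering s stuck (≤-trans W<X ∣X∣≤s))
      (λ W<X → no-covering s (reverse-stuck stuck) (≤-trans W<X ∣X∣≤s))
      j∈F u∈X v∉X tZ cov u∉Z

  -- Positive surplus gives an `F`-arc leaving `X`. It enters a tight set, which is disjoint from
  -- `X` or covers with it; both cases are excluded.
  not-stuck : ∀ {arc} → Stuck arc → ∀ {X} → Tight arc X → ⊥
  not-stuck {arc} stuck {X} tX =
    let j , eq = count-witness (≤-trans 1≤K (≤-trans (m≤m+n K _) (gain tX)))
        Fj , out = ∧-true eq
        j∈F = lookup⇒[]= j F Fj
        leavesX = enters⁻ {X = X} {a = rev (arc j)} out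
        Y , tY , entersY = cover j∈F
    in case disjoint-or-covering j tX tY leavesX entersY of λ where
      (inj₁ disjoint) → disjoint-free {arc}
        (no-covering _ (reverse-stuck stuck) ≤-refl (complement-tight tX)) tY disjoint j∈F leavesX entersY
      (inj₂ cov) → no-covering _ stuck ≤-refl tX tY cov j∈F leavesX entersY
    where
    open Stuck stuck
    open Uncrossing stuck

-- Reversing a single arc.

indeg-reverseArc : (j : Fin m) (D : Digraph n m) (X : Subset n) →
  indeg (reverseArc j D) X + bit (enters X (lookup D j)) ≡ indeg D X + bit (enters X (rev (lookup D j)))
indeg-reverseArc zero (a ∷ D) X =
  solve 3 (λ x y d → (y :+ d) :+ x := (x :+ d) :+ y) refl
    (bit (enters X a)) (bit (enters X (rev a))) (indeg D X)
  where open +-*-Solver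
indeg-reverseArc (suc j) (a ∷ D) X =
  trans (+-assoc (bit (enters X a)) _ _)
    (trans (cong (bit (enters X a) +_) (indeg-reverseArc j D X)) (sym (+-assoc (bit (enters X a)) _ _)))

-- The in-degree drops by at most one, and only if the arc enters `X`; a set that is not tight can
-- afford this.
≤-indeg-reverseArc : (D : Digraph n m) (X : Subset n) (j : Fin m) {l : ℕ} → l ≤ indeg D X →
  ¬ (indeg D X ≡ l × Enters X (lookup D j)) → l ≤ indeg (reverseArc j D) X
≤-indeg-reverseArc D X j {l} l≤ not-both with enters X (lookup D j) in eq | indeg-reverseArc j D X
... | false | change = begin
    l                                                  ≤⟨ l≤ ⟩
    indeg D X                                          ≤⟨ m≤m+n _ _ ⟩
    indeg D X + bit (enters X (rev (lookup D j)))      ≡⟨ change ⟨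
    indeg (reverseArc j D) X + 0                       ≡⟨ +-identityʳ _ ⟩
    indeg (reverseArc j D) X                           ∎
  where open ≤-Reasoning
... | true | change = +-cancelʳ-≤ 1 _ _ (begin
    l + 1                                              ≡⟨ +-comm l 1 ⟩
    1 + l                                              ≤⟨ ≤∧≢⇒< l≤ (λ l≡ → not-both (sym l≡ , enters⁻ eq)) ⟩
    indeg D X                                          ≤⟨ m≤m+n _ _ ⟩
    indeg D X + bit (enters X (rev (lookup D j)))      ≡⟨ change ⟨
    indeg (reverseArc j D) X + 1                       ∎)
  where open ≤-Reasoning

-- The numerical bounds and the conclusion.

double≤1+k : ∀ {l k} → l ≤ ⌊ k + 1 /2⌋ → l + l ≤ k + 1
double≤1+k {l} {k} l≤ = begin
    l + l                            ≤⟨ +-mono-≤ l≤ (≤-trans l≤ (⌊n/2⌋≤⌈n/2⌉ (k + 1))) ⟩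
    ⌊ k + 1 /2⌋ + ⌈ k + 1 /2⌉        ≡⟨ ⌊n/2⌋+⌈n/2⌉≡n (k + 1) ⟩
    k + 1                            ∎
  where open ≤-Reasoning

theorem8 : ∀ {n m} (D : Digraph n m) (k : ℕ) → 2 ≤ k → (F : Subset m) →
    (l : ℕ) → IsArcConnectivity D l → l ≤ ⌊ k + 1 /2⌋ →
    ArcConnected k (reverseSet F D) →
    Σ (Fin m) λ j → j ∈ F ×
    ((l′ : ℕ) → IsArcConnectivity (reverseArc j D) l′ → l ≤ l′)
theorem8 {n} {m} D k 2≤k F l ((X₀ , proper₀ , eq₀) , lower) l≤half connected =
  case any? (λ j → (j ∈? F) ×-dec ¬? (blocked? j)) of λ where
    (yes (j , j∈F , free)) → j , j∈F , λ l′ ((X , proper , eq) , _) →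
      subst (l ≤_) eq (≤-indeg-reverseArc D X j (lower X proper)
        λ (tight , entersX) → free (X , (proper , trans (sym (indeg≡count D X)) tight) , entersX))
    -- Every arc of `F` enters a tight set; the minimizer `X₀` is the tight set needed for the
    -- contradiction.
    (no none) → ⊥-elim (not-stuck (record
      { lower = λ {X} proper → subst (l ≤_) (indeg≡count D X) (lower X proper)
      ; gain = gain
      ; cover = λ {j} j∈F → decidable-stable (blocked? j) (λ free → none (j , j∈F , free))
      }) (proper₀ , trans (sym (indeg≡count D X₀)) eq₀))
  where
  -- Otherwise `k + k ≤ k + 1`, against `2 ≤ k`.
  l<k : l < k
  l<k = ≰⇒> λ k≤l → <-irrefl refl (begin-strict
      k + 1  <⟨ +-monoʳ-< k 2≤k ⟩
      k + k  ≤⟨ +-mono-≤ k≤l k≤l ⟩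
      l + l  ≤⟨ double≤1+k l≤half ⟩
      k + 1  ∎)
    where open ≤-Reasoning

  l+[k∸l]≡k : l + (k ∸ l) ≡ k
  l+[k∸l]≡k = m+[n∸m]≡n (<⇒≤ l<k)

  l≤1+[k∸l] : l ≤ suc (k ∸ l)
  l≤1+[k∸l] = +-cancelˡ-≤ l _ _ (begin
      l + l            ≤⟨ double≤1+k l≤half ⟩
      k + 1            ≡⟨ cong (_+ 1) l+[k∸l]≡k ⟨
      l + (k ∸ l) + 1  ≡⟨ +-assoc l (k ∸ l) 1 ⟩
      l + (k ∸ l + 1)  ≡⟨ cong (l +_) (+-comm (k ∸ l) 1) ⟩
      l + suc (k ∸ l)  ∎)
    where open ≤-Reasoning

  open Fixed {n} {m} F l (k ∸ l) (m<n⇒0<n∸m l<k) l≤1+[k∸l]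

  blocked? : ∀ j → Dec (∃ λ X → Tight (lookup D) X × Enters X (lookup D j))
  blocked? j = anySubset? λ X → tight? (lookup D) X ×-dec enters? X (lookup D j)

  -- After reversing `F` the in-degree of `X` is `l` plus its surplus, and it must reach `k`.
  gain : ∀ {X} → Tight (lookup D) X → k ∸ l + fin (lookup D) X ≤ fout (lookup D) X
  gain {X} (proper , tight) = +-cancelˡ-≤ l _ _ (begin
      l + (k ∸ l + fin (lookup D) X)               ≡⟨ +-assoc l (k ∸ l) _ ⟨
      l + (k ∸ l) + fin (lookup D) X               ≡⟨ cong (_+ fin (lookup D) X) l+[k∸l]≡k ⟩
      k + fin (lookup D) X                         ≤⟨ +-monoˡ-≤ _ (connected X proper) ⟩
      indeg (reverseSet F D) X + fin (lookup D) X  ≡⟨ indeg-reverseSet F D X ⟩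
      indeg D X + fout (lookup D) X                ≡⟨ cong (_+ fout (lookup D) X) (trans (indeg≡count D X) tight) ⟩
      l + fout (lookup D) X                        ∎)
    where open ≤-Reasoning
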